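{- For nonnegative integers $n$ and $\alpha$, $$\sum_{k=0}^n \binom{k+\alpha}{\alpha} |\mathcal{T}_{n,k}| = (n+1+\alpha)^n.$$
   Context: $\mathcal{T}_n$ is the set of rooted labeled trees on vertex set $[0,n]=\{0,\dots,n\}$. For $T\in\mathcal{T}_n$, the maximal decreasing subtree $\mathrm{MD}(T)$ is the subtree induced by the root and all vertices $v$ such that labels strictly decrease along the path from the root to $v$. $\mathcal{T}_{n,k}$ is the set of $T\in\mathcal{T}_n$ whose $\mathrm{MD}(T)$ has exactly $k+1$ vertices. Convention $0^0=1$. -}

module Defs where

open import Data.Nat using (ℕ; zero; suc; _+_; _<ᵇ_)
open import Data.Nat.GeneralisedArithmetic using (iterate)
open import Data.Fin using (Fin; toℕ)
open import Data.Fin.Properties using (_≟_)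
open import Data.Vec using (Vec; lookup)
open import Data.List using (List; length; filterᵇ; map; upTo; allFin)
open import Data.Nat.ListAction using (sum)
open import Data.Bool.ListAction using (all)
open import Data.Bool using (Bool; true; false; _∧_; _∨_; T)
open import Data.Product using (Σ; _×_; _,_; proj₁; proj₂)
open import Relation.Nullary.Decidable using (⌊_⌋)
open import Relation.Binary.PropositionalEquality using (_≡_)

Vertex : ℕ → Set
Vertex n = Fin (suc n)

_==_ : ∀ {n} → Vertex n → Vertex n → Bool
u == v = ⌊ u ≟ v ⌋

-- A rooted labeled tree on [0,n] is encoded by its root r and its parent
-- map p (stored as a vector), normalised by p r = r, such that every vertex
-- reaches the root by following parents (n steps always suffice, and since
-- p r = r, reaching r within n steps is the same as p^n v = r).
-- This encoding is in bijection with rooted labeled trees (edges {v, p v}, v ≠ r).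
-- Conditions are Bool-valued (T b is proof-irrelevant), so distinct
-- elements of the type are exactly distinct trees.
IsRootedTree : (n : ℕ) → Vertex n → Vec (Vertex n) (suc n) → Bool
IsRootedTree n r p =
  (lookup p r == r) ∧ all (λ v → iterate (lookup p) v n == r) (allFin (suc n))

RootedTree : ℕ → Set
RootedTree n = Σ (Vertex n × Vec (Vertex n) (suc n))
                 (λ rp → T (IsRootedTree n (proj₁ rp) (proj₂ rp)))

-- decreasingPath fuel v : the labels strictly decrease along the path from
-- the root to v, i.e. every non-root vertex w on that path has label smaller
-- than its parent.  Fuel n suffices since paths have at most n edges.
decreasingPath : ∀ {n} → Vertex n → Vec (Vertex n) (suc n) → ℕ → Vertex n → Bool
decreasingPath r p zero v = v == r
decreasingPath r p (suc f) v =
  (v == r) ∨ ((toℕ v <ᵇ toℕ (lookup p v)) ∧ decreasingPath r p f (lookup p v))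

-- number of vertices of the maximal decreasing subtree MD(T) (root included)
mdSize : ∀ {n} → RootedTree n → ℕ
mdSize {n} ((r , p) , _) = length (filterᵇ (decreasingPath r p n) (allFin (suc n)))

TreeNK : ℕ → ℕ → Set
TreeNK n k = Σ (RootedTree n) (λ t → mdSize t ≡ suc k)

sumTo : ℕ → (ℕ → ℕ) → ℕ
sumTo n f = sum (map f (upTo (suc n)))

{-# OPTIONS --safe #-}
module Submission where

-- Contract the vertices one at a time into their parents, from the largest
-- label down.  During this process the possible parents (all N = n + 1 labels)
-- are only remembered by what they have been merged into: a vertex not yet
-- contracted, or the finished part containing the root.  A label merged into
-- the finished part is good if its path from the root is decreasing; a child
-- c of a label x already contracted has c < x, so c is good iff x is, whereas
-- the larger labels merged into c before are not good.
--
-- Let g labels be good and B be finished but not good, with m vertices left,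
-- and let y labels be merged into the largest vertex left (itself included).
-- Each of the g good choices of its parent changes (g , B) to
-- (g + 1 , B + y - 1), each of the B others in the finished part changes it
-- to (g , B + y), and the N - g - B - y labels merged into another remaining
-- vertex change nothing.  Hence, with f k = C(k+α, α) and
-- g f(g) = (g+α) f(g-1), the weighted number of completions times N + α is
-- f(g-1) (g+B+α) (N+α)^m by induction on m.  Before the root has been met it
-- is (N+α)^m, and m = N is the theorem.

open import Defs
open import Data.Nat using (ℕ; zero; suc; _+_; _*_; _^_; _∸_; _≤_; _<_; _≡ᵇ_; z≤n; s≤s)
open import Data.Nat.Combinatorics using (_C_; nCk+nC[k+1]≡[n+1]C[k+1]; nC1≡n; nCn≡1; nCk≡nC[n∸k])
open import Data.Fin using (Fin)
open import Function.Bundles using (_↔_; mk↔ₛ′; Equivalence)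
open import Relation.Binary.PropositionalEquality using (_≡_)

import Data.Nat.Properties as ℕ
open import Algebra.Properties.Semiring.Sum ℕ.+-*-semiring
  using (sum-cong-≗; ∑-distrib-+; ∑-comm; ∑-permute; *-distribˡ-sum; *-distribʳ-sum; sum-replicate-zero; sum-syntax)
open import Data.Bool using (Bool; true; false; T; if_then_else_)
open import Data.Bool.Properties using (T-∧; T-∨; T-≡; T-irrelevant)
import Data.Fin as F
open import Data.Fin using (zero; suc; toℕ; opposite; punchOut)
import Data.Fin.Permutation as Permutation
import Data.Fin.Properties as F
open import Data.List using (length; filterᵇ; map; applyUpTo; tabulate; allFin)
open import Data.List.Relation.Unary.All.Properties using (all⁺; all⁻; tabulate⁺; tabulate⁻)
open import Data.Maybe using (Maybe; just; nothing; maybe; is-just)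
open import Data.Maybe.Properties using (just-injective)
import Data.Nat.ListAction as List
open import Data.Nat.GeneralisedArithmetic using (iterate)
open import Data.Nat.Tactic.RingSolver using (solve-∀)
open import Data.Product using (Σ; ∃; ∃₂; _×_; _,_; proj₁; proj₂; uncurry)
open import Data.Product.Function.Dependent.Propositional using (congˡ)
open import Data.Sum using (_⊎_; inj₁; inj₂)
open import Data.Sum.Function.Propositional using (_⊎-cong_)
open import Data.Vec as Vec using (Vec; []; _∷_; lookup)
open import Data.Vec.Properties using (lookup∘tabulate; tabulate-cong; tabulate∘lookup)
open import Function using (_∘_)
open import Function.Properties.Inverse using (↔-refl; ↔-sym; ↔-trans)
open import Relation.Binary.PropositionalEquality using (_≢_; refl; sym; trans; cong; cong₂; subst; module ≡-Reasoning)
open import Relation.Nullary using (¬_; yes; no; contradiction)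
open import Relation.Nullary.Decidable using (toWitness; fromWitness)

-- Finite sums, indicators and binomial coefficients.

indicator : Bool → ℕ
indicator b = if b then 1 else 0

sum-applyUpTo : ∀ (f g : ℕ → ℕ) m →
  List.sum (map f (applyUpTo g m)) ≡ ∑[ i < m ] f (g (toℕ i))
sum-applyUpTo f g zero    = refl
sum-applyUpTo f g (suc m) = cong (f (g 0) +_) (sum-applyUpTo f (g ∘ suc) m)

length-filterᵇ-tabulate : ∀ {A : Set} (P : A → Bool) {m} (g : Fin m → A) →
  length (filterᵇ P (tabulate g)) ≡ ∑[ i < m ] indicator (P (g i))
length-filterᵇ-tabulate P {zero}  g = refl
length-filterᵇ-tabulate P {suc m} g with P (g zero)
... | true  = cong suc (length-filterᵇ-tabulate P (g ∘ suc))
... | false = length-filterᵇ-tabulate P (g ∘ suc)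

∑-indicator-≡ᵇ : ∀ (f : ℕ → ℕ) {j m} → j < m →
  ∑[ i < m ] (f (toℕ i) * indicator (j ≡ᵇ toℕ i)) ≡ f j
∑-indicator-≡ᵇ f {zero}  {suc m} _ = begin
  f 0 * 1 + ∑[ i < m ] (f (suc (toℕ i)) * 0) ≡⟨ cong₂ _+_ (ℕ.*-identityʳ (f 0)) (sum-cong-≗ {m} (λ i → ℕ.*-zeroʳ (f (suc (toℕ i))))) ⟩
  f 0 + ∑[ i < m ] 0                         ≡⟨ cong (f 0 +_) (sum-replicate-zero m) ⟩
  f 0 + 0                                    ≡⟨ ℕ.+-identityʳ (f 0) ⟩
  f 0                                        ∎
  where open ≡-Reasoning
∑-indicator-≡ᵇ f {suc j} {suc m} (s≤s j<m) =
  cong₂ _+_ (ℕ.*-zeroʳ (f 0)) (∑-indicator-≡ᵇ (f ∘ suc) j<m)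

∑-const-1 : ∀ m → ∑[ i < m ] 1 ≡ m
∑-const-1 zero    = refl
∑-const-1 (suc m) = cong suc (∑-const-1 m)

-- The absorption identity, by induction on `n`: Pascal's rule splits the left side, and one copy of
-- `b` is set aside so that both induction hypotheses apply.
[1+k]*[1+n]C[1+k]≡[1+n]*nCk : ∀ n k → suc k * (suc n C suc k) ≡ suc n * (n C k)
[1+k]*[1+n]C[1+k]≡[1+n]*nCk zero    zero    = refl
[1+k]*[1+n]C[1+k]≡[1+n]*nCk zero    (suc k) = ℕ.*-zeroʳ (suc (suc k))
[1+k]*[1+n]C[1+k]≡[1+n]*nCk (suc n) zero    = trans (ℕ.*-identityˡ _) (trans (nC1≡n (suc (suc n))) (sym (ℕ.*-identityʳ _)))
[1+k]*[1+n]C[1+k]≡[1+n]*nCk (suc n) (suc k) = begin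
  suc (suc k) * (suc (suc n) C suc (suc k))
    ≡⟨ cong (suc (suc k) *_) (nCk+nC[k+1]≡[n+1]C[k+1] (suc n) (suc k)) ⟨
  suc (suc k) * (b + (suc n C suc (suc k)))
    ≡⟨ ℕ.*-distribˡ-+ (suc (suc k)) b _ ⟩
  suc (suc k) * b + suc (suc k) * (suc n C suc (suc k))
    ≡⟨ cong₂ (λ x y → (b + x) + y) ([1+k]*[1+n]C[1+k]≡[1+n]*nCk n k) ([1+k]*[1+n]C[1+k]≡[1+n]*nCk n (suc k)) ⟩
  (b + suc n * (n C k)) + suc n * (n C suc k)
    ≡⟨ ℕ.+-assoc b _ _ ⟩
  b + (suc n * (n C k) + suc n * (n C suc k))
    ≡⟨ cong (b +_) (ℕ.*-distribˡ-+ (suc n) (n C k) (n C suc k)) ⟨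
  b + suc n * (n C k + n C suc k)
    ≡⟨ cong (λ x → b + suc n * x) (nCk+nC[k+1]≡[n+1]C[k+1] n k) ⟩
  suc (suc n) * b ∎
  where
  open ≡-Reasoning
  b : ℕ
  b = suc n C suc k

[k+a]Ca≡[k+a]Ck : ∀ k a → (k + a) C a ≡ (k + a) C k
[k+a]Ca≡[k+a]Ck k a = trans (nCk≡nC[n∸k] (ℕ.m≤n+m a k)) (cong ((k + a) C_) (ℕ.m+n∸n≡m k a))

-- Absorption applied to the complementary lower index. In `V-rooted` it trades the weight with one
-- more good label for the weight before the step.
[1+k]*[1+k+a]Ca≡[1+k+a]*[k+a]Ca : ∀ k a → suc k * ((suc k + a) C a) ≡ (suc k + a) * ((k + a) C a)
[1+k]*[1+k+a]Ca≡[1+k+a]*[k+a]Ca k a = begin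
  suc k * ((suc k + a) C a)     ≡⟨ cong (suc k *_) ([k+a]Ca≡[k+a]Ck (suc k) a) ⟩
  suc k * ((suc k + a) C suc k) ≡⟨ [1+k]*[1+n]C[1+k]≡[1+n]*nCk (k + a) k ⟩
  (suc k + a) * ((k + a) C k)   ≡⟨ cong ((suc k + a) *_) ([k+a]Ca≡[k+a]Ck k a) ⟨
  (suc k + a) * ((k + a) C a)   ∎
  where open ≡-Reasoning

-- The contraction process.

-- `at b j` is the j-th largest of the m remaining vertices, where b says that
-- the label is this vertex itself and not one merged into it; `done b` is the
-- finished part, where b says that the label is good.
data Target (m : ℕ) : Set where
  at   : Bool → Fin m → Target m
  done : Bool → Target m

good bad : ∀ {m} → Target m → ℕ
good (done true)  = 1
good _            = 0
bad (done false)  = 1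
bad _             = 0

isAt : ∀ {m} → Fin m → Target m → ℕ
isAt j (at true i) = indicator (toℕ j ≡ᵇ toℕ i)
isAt j _           = 0

-- Of the labels at the largest vertex, `badHere` counts those other than the vertex itself: as its
-- parent they would close a cycle, and they turn bad when it is contracted into the finished part.
badHere there : ∀ {m} → Target (suc m) → ℕ
badHere (at false zero) = 1
badHere _               = 0
there (at _ (suc _)) = 1
there _              = 0

block : ∀ {m} → Target m → Target m
block (at _ j) = at false j
block (done _) = done false

contract : ∀ {m} → Target m → Target (suc m) → Target m
contract t (at true zero)  = t
contract t (at false zero) = block t
contract t (at b (suc j))  = at b j
contract t (done b)        = done b

module _ {N : ℕ} where

  State : ℕ → Set
  State m = Fin N → Target m

  # : ∀ {m} → (Target m → ℕ) → State m → ℕ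
  # i φ = ∑[ c < N ] i (φ c)

  -- The Boolean of `step` and `run` records whether the root has been met; the
  -- root is the vertex that is its own parent, and `nothing` signals a cycle
  -- or a second root.
  step : ∀ {m} → Bool → State (suc m) → Target (suc m) → Maybe (Bool × State m)
  step b φ (at true zero)  = if b then nothing else just (true , contract (done true) ∘ φ)
  step b φ (at false zero) = nothing
  step b φ (at _ (suc j))  = just (b , contract (at false j) ∘ φ)
  step b φ (done d)        = just (b , contract (done d) ∘ φ)

  run : ∀ {m} → ℕ → Bool → State m → Vec (Fin N) m → Bool
  run k b φ []      = # good φ ≡ᵇ suc k
  run k b φ (c ∷ q) = maybe (λ (b′ , ψ) → run k b′ ψ q) false (step b φ (φ c))

  count : ∀ {m} → (Vec (Fin N) m → Bool) → ℕ
  count {zero}  P = indicator (P [])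
  count {suc m} P = ∑[ c < N ] count (λ q → P (c ∷ q))

  -- Numbers of labels of each kind under a contraction.

  #-cong : ∀ {m} {i j : Target m → ℕ} (φ : State m) → (∀ t → i t ≡ j t) → # i φ ≡ # j φ
  #-cong φ i≗j = sum-cong-≗ (i≗j ∘ φ)

  #-+ : ∀ {m} (i j : Target m → ℕ) (φ : State m) → # (λ t → i t + j t) φ ≡ # i φ + # j φ
  #-+ i j φ = ∑-distrib-+ (i ∘ φ) (j ∘ φ)

  #-* : ∀ {m} (i : Target m → ℕ) x (φ : State m) → # (λ t → i t * x) φ ≡ # i φ * x
  #-* i x φ = sym (*-distribʳ-sum x (i ∘ φ))

  #-1 : ∀ {m} (φ : State m) → # (λ _ → 1) φ ≡ N
  #-1 φ = ∑-const-1 N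

  count-false : ∀ m → count {m} (λ _ → false) ≡ 0
  count-false zero    = refl
  count-false (suc m) = trans (sum-cong-≗ {N} (λ _ → count-false m)) (sum-replicate-zero N)

  -- Besides the numbers of good and bad labels, this is all that the closed forms ask of a state;
  -- it need not be reachable from `start`.
  Unique : ∀ {m} → State m → Set
  Unique φ = ∀ j → # (isAt j) φ ≡ 1

  good-contract-true : ∀ {m} (φ : State (suc m)) → Unique φ →
    # good (contract (done true) ∘ φ) ≡ suc (# good φ)
  good-contract-true φ unique = begin
    # (good ∘ contract (done true)) φ         ≡⟨ #-cong φ pointwise ⟩
    # (λ t → isAt zero t + good t) φ          ≡⟨ #-+ (isAt zero) good φ ⟩
    # (isAt zero) φ + # good φ                ≡⟨ cong (_+ # good φ) (unique zero) ⟩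
    suc (# good φ)                            ∎
    where
    open ≡-Reasoning
    pointwise : ∀ t → good (contract (done true) t) ≡ isAt zero t + good t
    pointwise (at true zero)     = refl
    pointwise (at false zero)    = refl
    pointwise (at true (suc _))  = refl
    pointwise (at false (suc _)) = refl
    pointwise (done true)        = refl
    pointwise (done false)       = refl

  bad-contract-true : ∀ {m} (φ : State (suc m)) →
    # bad (contract (done true) ∘ φ) ≡ # badHere φ + # bad φ
  bad-contract-true φ = trans (#-cong φ pointwise) (#-+ badHere bad φ)
    where
    pointwise : ∀ t → bad (contract (done true) t) ≡ badHere t + bad t
    pointwise (at true zero)     = refl
    pointwise (at false zero)    = refl
    pointwise (at true (suc _))  = refl
    pointwise (at false (suc _)) = refl
    pointwise (done true)        = refl
    pointwise (done false)       = refl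

  good-contract-false : ∀ {m} (φ : State (suc m)) →
    # good (contract (done false) ∘ φ) ≡ # good φ
  good-contract-false φ = #-cong φ pointwise
    where
    pointwise : ∀ t → good (contract (done false) t) ≡ good t
    pointwise (at true zero)     = refl
    pointwise (at false zero)    = refl
    pointwise (at true (suc _))  = refl
    pointwise (at false (suc _)) = refl
    pointwise (done true)        = refl
    pointwise (done false)       = refl

  bad-contract-false : ∀ {m} (φ : State (suc m)) → Unique φ →
    # bad (contract (done false) ∘ φ) ≡ suc (# badHere φ + # bad φ)
  bad-contract-false φ unique = begin
    # (bad ∘ contract (done false)) φ                ≡⟨ #-cong φ pointwise ⟩
    # (λ t → isAt zero t + (badHere t + bad t)) φ    ≡⟨ #-+ (isAt zero) (λ t → badHere t + bad t) φ ⟩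
    # (isAt zero) φ + # (λ t → badHere t + bad t) φ  ≡⟨ cong₂ _+_ (unique zero) (#-+ badHere bad φ) ⟩
    suc (# badHere φ + # bad φ)                      ∎
    where
    open ≡-Reasoning
    pointwise : ∀ t → bad (contract (done false) t) ≡ isAt zero t + (badHere t + bad t)
    pointwise (at true zero)     = refl
    pointwise (at false zero)    = refl
    pointwise (at true (suc _))  = refl
    pointwise (at false (suc _)) = refl
    pointwise (done true)        = refl
    pointwise (done false)       = refl

  good-contract-at : ∀ {m} (φ : State (suc m)) j →
    # good (contract (at false j) ∘ φ) ≡ # good φ
  good-contract-at φ j = #-cong φ pointwise
    where
    pointwise : ∀ t → good (contract (at false j) t) ≡ good t
    pointwise (at true zero)     = refl
    pointwise (at false zero)    = refl
    pointwise (at true (suc _))  = refl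
    pointwise (at false (suc _)) = refl
    pointwise (done true)        = refl
    pointwise (done false)       = refl

  bad-contract-at : ∀ {m} (φ : State (suc m)) j →
    # bad (contract (at false j) ∘ φ) ≡ # bad φ
  bad-contract-at φ j = #-cong φ pointwise
    where
    pointwise : ∀ t → bad (contract (at false j) t) ≡ bad t
    pointwise (at true zero)     = refl
    pointwise (at false zero)    = refl
    pointwise (at true (suc _))  = refl
    pointwise (at false (suc _)) = refl
    pointwise (done true)        = refl
    pointwise (done false)       = refl

  -- The only target that `contract` can turn into `at true j` is
  -- `at true (suc j)`, because `t` itself is never of that form.
  unique-contract : ∀ {m} t → (∀ j → isAt {m} j t ≡ 0) →
    (φ : State (suc m)) → Unique φ → Unique (contract t ∘ φ)
  unique-contract t t-not-at φ unique j = trans (#-cong φ pointwise) (unique (suc j))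
    where
    block-not-at : ∀ {m} (j : Fin m) t → isAt j (block t) ≡ 0
    block-not-at j (at _ _) = refl
    block-not-at j (done _) = refl
    pointwise : ∀ x → isAt j (contract t x) ≡ isAt (suc j) x
    pointwise (at true zero)     = t-not-at j
    pointwise (at false zero)    = block-not-at j t
    pointwise (at true (suc _))  = refl
    pointwise (at false (suc _)) = refl
    pointwise (done _)           = refl

  total-[] : (φ : State 0) → # good φ + # bad φ ≡ N
  total-[] φ = trans (sym (#-+ good bad φ)) (trans (#-cong φ pointwise) (#-1 φ))
    where
    pointwise : ∀ t → good {0} t + bad t ≡ 1
    pointwise (done true)  = refl
    pointwise (done false) = refl

  -- A label is good, bad, the largest vertex, merged into that vertex, or at another vertex: the
  -- five indicators add up to 1, and `unique` evaluates the third sum.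
  total-suc : ∀ {m} (φ : State (suc m)) → Unique φ →
    # good φ + # bad φ + suc (# badHere φ + # there φ) ≡ N
  total-suc φ unique = begin
    # good φ + # bad φ + suc (# badHere φ + # there φ)
      ≡⟨ cong (λ x → # good φ + # bad φ + (x + (# badHere φ + # there φ))) (unique zero) ⟨
    # good φ + # bad φ + (# (isAt zero) φ + (# badHere φ + # there φ))
      ≡⟨ cong₂ _+_ (#-+ good bad φ) (trans (#-+ (isAt zero) (λ t → badHere t + there t) φ) (cong (# (isAt zero) φ +_) (#-+ badHere there φ))) ⟨
    # (λ t → good t + bad t) φ + # (λ t → isAt zero t + (badHere t + there t)) φ
      ≡⟨ #-+ (λ t → good t + bad t) (λ t → isAt zero t + (badHere t + there t)) φ ⟨
    # (λ t → good t + bad t + (isAt zero t + (badHere t + there t))) φ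
      ≡⟨ #-cong φ pointwise ⟩
    # (λ _ → 1) φ ≡⟨ #-1 φ ⟩
    N ∎
    where
    open ≡-Reasoning
    pointwise : ∀ t → good t + bad t + (isAt zero t + (badHere t + there t)) ≡ 1
    pointwise (at true zero)     = refl
    pointwise (at false zero)    = refl
    pointwise (at true (suc _))  = refl
    pointwise (at false (suc _)) = refl
    pointwise (done true)        = refl
    pointwise (done false)       = refl

  -- Closed form of the weighted count.

  module _ (α : ℕ) where
    weight : ℕ → ℕ
    weight k = (k + α) C α

    M : ℕ
    M = N + α

    -- The weighted number of completions: a parent vector that ends with `suc k` good labels
    -- contributes `weight k`. The range of `k` suffices, as at most `N` labels are good.
    W : ∀ {m} → Bool → State m → ℕ
    W b φ = ∑[ k < N ] (weight (toℕ k) * count (run (toℕ k) b φ))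

    W-nothing : ∀ m → ∑[ k < N ] (weight (toℕ k) * count {m} (λ _ → false)) ≡ 0
    W-nothing m = trans (sum-cong-≗ {N} (λ k → trans (cong (weight (toℕ k) *_) (count-false m)) (ℕ.*-zeroʳ (weight (toℕ k))))) (sum-replicate-zero N)

    W-[] : ∀ b (φ : State 0) g → # good φ ≡ suc g → g < N → W b φ ≡ weight g
    W-[] b φ g eq g<N = trans
      (sum-cong-≗ {N} (λ k → cong (λ x → weight (toℕ k) * indicator (x ≡ᵇ suc (toℕ k))) eq))
      (∑-indicator-≡ᵇ weight g<N)

    W-step : ∀ {m} b (φ : State (suc m)) → W b φ ≡ ∑[ c < N ] maybe (uncurry W) 0 (step b φ (φ c))
    W-step {m} b φ = begin
      ∑[ k < N ] (weight (toℕ k) * ∑[ c < N ] count (λ q → run (toℕ k) b φ (c ∷ q)))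
        ≡⟨ sum-cong-≗ {N} (λ k → *-distribˡ-sum (weight (toℕ k)) (λ c → count (λ q → run (toℕ k) b φ (c ∷ q)))) ⟩
      ∑[ k < N ] ∑[ c < N ] (weight (toℕ k) * count (λ q → run (toℕ k) b φ (c ∷ q)))
        ≡⟨ ∑-comm {N} {N} (λ k c → weight (toℕ k) * count (λ q → run (toℕ k) b φ (c ∷ q))) ⟩
      ∑[ c < N ] ∑[ k < N ] (weight (toℕ k) * count (λ q → run (toℕ k) b φ (c ∷ q)))
        ≡⟨ sum-cong-≗ {N} each ⟩
      ∑[ c < N ] maybe (uncurry W) 0 (step b φ (φ c)) ∎
      where
      open ≡-Reasoning
      each : ∀ c → ∑[ k < N ] (weight (toℕ k) * count (λ q → run (toℕ k) b φ (c ∷ q))) ≡ maybe (uncurry W) 0 (step b φ (φ c))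
      each c with step b φ (φ c)
      ... | just _  = refl
      ... | nothing = W-nothing m

    -- The factor M makes the closed forms of V-rooted and V-unrooted uniform in m.
    V : ∀ {m} → Bool → State m → ℕ
    V b φ = W b φ * M

    V-step : ∀ {m} b (φ : State (suc m)) → V b φ ≡ # (maybe (uncurry V) 0 ∘ step b φ) φ
    V-step b φ = begin
      W b φ * M
        ≡⟨ cong (_* M) (W-step b φ) ⟩
      # (maybe (uncurry W) 0 ∘ step b φ) φ * M
        ≡⟨ #-* (maybe (uncurry W) 0 ∘ step b φ) M φ ⟨
      # (λ t → maybe (uncurry W) 0 (step b φ t) * M) φ
        ≡⟨ #-cong φ (λ t → maybe-* (step b φ t)) ⟩
      # (maybe (uncurry V) 0 ∘ step b φ) φ ∎
      where
      open ≡-Reasoning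
      maybe-* : ∀ x → maybe (uncurry W) 0 x * M ≡ maybe (uncurry V) 0 x
      maybe-* (just _) = refl
      maybe-* nothing  = refl

    -- All choices of a parent among the remaining vertices turn out to
    -- contribute the same amount D.
    V-split : ∀ {m} b (φ : State (suc m)) D →
      (∀ j → V b (contract (at false j) ∘ φ) ≡ D) →
      V b φ ≡ # good φ * V b (contract (done true) ∘ φ)
            + # bad φ * V b (contract (done false) ∘ φ)
            + # (isAt zero) φ * maybe (uncurry V) 0 (step b φ (at true zero))
            + # there φ * D
    V-split {m} b φ D V≡D = begin
      V b φ ≡⟨ V-step b φ ⟩
      # (maybe (uncurry V) 0 ∘ step b φ) φ ≡⟨ #-cong φ pointwise ⟩
      # (λ t → good t * A + bad t * B + isAt zero t * E + there t * D) φ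
        ≡⟨ #-+ (λ t → good t * A + bad t * B + isAt zero t * E) (λ t → there t * D) φ ⟩
      # (λ t → good t * A + bad t * B + isAt zero t * E) φ + # (λ t → there t * D) φ
        ≡⟨ cong₂ _+_ (#-+ (λ t → good t * A + bad t * B) (λ t → isAt zero t * E) φ) (#-* there D φ) ⟩
      # (λ t → good t * A + bad t * B) φ + # (λ t → isAt zero t * E) φ + # there φ * D
        ≡⟨ cong (_+ # there φ * D) (cong₂ _+_ (#-+ (λ t → good t * A) (λ t → bad t * B) φ) (#-* (isAt zero) E φ)) ⟩
      # (λ t → good t * A) φ + # (λ t → bad t * B) φ + # (isAt zero) φ * E + # there φ * D
        ≡⟨ cong (λ x → x + # (isAt zero) φ * E + # there φ * D) (cong₂ _+_ (#-* good A φ) (#-* bad B φ)) ⟩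
      # good φ * A + # bad φ * B + # (isAt zero) φ * E + # there φ * D ∎
      where
      open ≡-Reasoning
      A = V b (contract (done true) ∘ φ)
      B = V b (contract (done false) ∘ φ)
      E = maybe (uncurry V) 0 (step b φ (at true zero))
      x≡x+0+0+0+0 : ∀ x → x ≡ x + 0 + 0 + 0 + 0
      x≡x+0+0+0+0 = solve-∀
      x≡x+0+0+0 : ∀ x → x ≡ x + 0 + 0 + 0
      x≡x+0+0+0 = solve-∀
      pointwise : ∀ t → maybe (uncurry V) 0 (step b φ t) ≡
        good t * A + bad t * B + isAt zero t * E + there t * D
      pointwise (at true zero)      = sym (trans (ℕ.+-identityʳ _) (ℕ.+-identityʳ _))
      pointwise (at false zero)     = refl
      pointwise (at true (suc j))   = trans (V≡D j) (sym (ℕ.+-identityʳ _))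
      pointwise (at false (suc j))  = trans (V≡D j) (sym (ℕ.+-identityʳ _))
      pointwise (done true)         = x≡x+0+0+0+0 _
      pointwise (done false)        = x≡x+0+0+0 _

    -- Induction on `m`; put s = g + 1 + α and leave out the common factor `weight g * P`. Both
    -- kinds of choice in the finished part enlarge it by Z + 1 labels and so share the factor s + B
    -- + Z + 1; their coefficients, s by the recurrence of the weights and B, add up to s + B. The R
    -- choices elsewhere contribute s + B each, and s + B + Z + 1 + R is `M` because the five
    -- classes exhaust the labels. For `m = 0` all labels are finished, so s + B is itself `M`.
    V-rooted : ∀ m (φ : State m) g → Unique φ → # good φ ≡ suc g →
      V true φ ≡ weight g * ((suc g + # bad φ + α) * M ^ m)
    V-rooted zero φ g unique good≡ = begin
      W true φ * M                              ≡⟨ cong (_* M) (W-[] true φ g good≡ g<N) ⟩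
      weight g * (N + α)                        ≡⟨ cong (λ x → weight g * (x + α)) total ⟨
      weight g * (suc g + # bad φ + α)          ≡⟨ cong (weight g *_) (ℕ.*-identityʳ _) ⟨
      weight g * ((suc g + # bad φ + α) * 1)    ∎
      where
      open ≡-Reasoning
      total : suc g + # bad φ ≡ N
      total = trans (cong (_+ # bad φ) (sym good≡)) (total-[] φ)
      g<N : g < N
      g<N = subst (suc g ≤_) total (ℕ.m≤m+n (suc g) (# bad φ))
    V-rooted (suc m) φ g unique good≡ = begin
      V true φ
        ≡⟨ V-split true φ (weight g * ((suc g + B + α) * P)) V-at ⟩
      -- The factor 0 stands for a second root, on which `step` fails.
      # good φ * V true (contract (done true) ∘ φ) + B * V true (contract (done false) ∘ φ)
        + # (isAt zero) φ * 0 + R * (weight g * ((suc g + B + α) * P))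
        ≡⟨ cong₂ (λ x y → x + y + # (isAt zero) φ * 0 + R * (weight g * ((suc g + B + α) * P))) (cong₂ _*_ good≡ V-true) (cong (B *_) V-false) ⟩
      suc g * (weight (suc g) * ((suc (suc g) + (Z + B) + α) * P)) + B * (weight g * ((suc g + suc (Z + B) + α) * P))
        + # (isAt zero) φ * 0 + R * (weight g * ((suc g + B + α) * P))
        ≡⟨ arithmetic₁ (suc g) (weight (suc g)) (weight g) B Z R (# (isAt zero) φ) α P ⟩
      suc g * weight (suc g) * ((suc (suc g) + (Z + B) + α) * P) + weight g * ((B * (suc g + suc (Z + B) + α) + R * (suc g + B + α)) * P)
        ≡⟨ cong (λ x → x * ((suc (suc g) + (Z + B) + α) * P) + weight g * ((B * (suc g + suc (Z + B) + α) + R * (suc g + B + α)) * P)) ([1+k]*[1+k+a]Ca≡[1+k+a]*[k+a]Ca g α) ⟩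
      (suc g + α) * weight g * ((suc (suc g) + (Z + B) + α) * P) + weight g * ((B * (suc g + suc (Z + B) + α) + R * (suc g + B + α)) * P)
        ≡⟨ arithmetic₂ g (weight g) B Z R α P ⟩
      weight g * ((suc g + B + α) * ((suc g + B + suc (Z + R) + α) * P))
        ≡⟨ cong (λ x → weight g * ((suc g + B + α) * ((x + α) * P))) total ⟩
      weight g * ((suc g + B + α) * (M * P)) ∎
      where
      open ≡-Reasoning
      B = # bad φ
      Z = # badHere φ
      R = # there φ
      P = M ^ m
      total : suc g + B + suc (Z + R) ≡ N
      total = trans (cong (λ x → x + B + suc (Z + R)) (sym good≡)) (total-suc φ unique)
      V-true : V true (contract (done true) ∘ φ) ≡ weight (suc g) * ((suc (suc g) + (Z + B) + α) * P)
      V-true = trans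
        (V-rooted m _ (suc g) (unique-contract (done true) (λ _ → refl) φ unique) (trans (good-contract-true φ unique) (cong suc good≡)))
        (cong (λ x → weight (suc g) * ((suc (suc g) + x + α) * P)) (bad-contract-true φ))
      V-false : V true (contract (done false) ∘ φ) ≡ weight g * ((suc g + suc (Z + B) + α) * P)
      V-false = trans
        (V-rooted m _ g (unique-contract (done false) (λ _ → refl) φ unique) (trans (good-contract-false φ) good≡))
        (cong (λ x → weight g * ((suc g + x + α) * P)) (bad-contract-false φ unique))
      V-at : ∀ j → V true (contract (at false j) ∘ φ) ≡ weight g * ((suc g + B + α) * P)
      V-at j = trans
        (V-rooted m _ g (unique-contract (at false j) (λ _ → refl) φ unique) (trans (good-contract-at φ j) good≡))
        (cong (λ x → weight g * ((suc g + x + α) * P)) (bad-contract-at φ j))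
      arithmetic₁ : ∀ g f′ f B Z R z α P →
        g * (f′ * ((suc g + (Z + B) + α) * P)) + B * (f * ((g + suc (Z + B) + α) * P)) + z * 0 + R * (f * ((g + B + α) * P))
        ≡ g * f′ * ((suc g + (Z + B) + α) * P) + f * ((B * (g + suc (Z + B) + α) + R * (g + B + α)) * P)
      arithmetic₁ = solve-∀
      arithmetic₂ : ∀ g f B Z R α P →
        (suc g + α) * f * ((suc (suc g) + (Z + B) + α) * P) + f * ((B * (suc g + suc (Z + B) + α) + R * (suc g + B + α)) * P)
        ≡ f * ((suc g + B + α) * ((suc g + B + suc (Z + R) + α) * P))
      arithmetic₂ = solve-∀

    -- The finished part is empty, so the largest vertex either becomes the root, in one way, or has
    -- one of the R labels at other vertices as parent; the Z labels merged into it give cycles. The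
    -- root case yields 1 + Z + α, which makes up for the lost Z and brings in α. With no vertex
    -- left all `N` labels would be finished, so `m = 0` cannot occur.
    V-unrooted : ∀ m (φ : State m) → Unique φ → # good φ ≡ 0 → # bad φ ≡ 0 → 0 < N →
      V false φ ≡ M ^ m
    V-unrooted zero φ unique good≡ bad≡ 0<N =
      contradiction (trans (sym (total-[] φ)) (cong₂ _+_ good≡ bad≡)) (ℕ.>⇒≢ 0<N)
    V-unrooted (suc m) φ unique good≡ bad≡ 0<N = begin
      V false φ
        ≡⟨ V-split false φ P V-at ⟩
      # good φ * V false (contract (done true) ∘ φ) + # bad φ * V false (contract (done false) ∘ φ)
        + # (isAt zero) φ * V true (contract (done true) ∘ φ) + R * P
        ≡⟨ cong₂ (λ x y → x * V false (contract (done true) ∘ φ) + y * V false (contract (done false) ∘ φ)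
                          + # (isAt zero) φ * V true (contract (done true) ∘ φ) + R * P) good≡ bad≡ ⟩
      # (isAt zero) φ * V true (contract (done true) ∘ φ) + R * P
        ≡⟨ cong (_+ R * P) (cong₂ _*_ (unique zero) V-root) ⟩
      1 * (1 * ((1 + Z + α) * P)) + R * P
        ≡⟨ arithmetic Z R α P ⟩
      (suc (Z + R) + α) * P
        ≡⟨ cong (λ x → (x + α) * P) total ⟩
      M * P ∎
      where
      open ≡-Reasoning
      Z = # badHere φ
      R = # there φ
      P = M ^ m
      total : suc (Z + R) ≡ N
      total = trans (cong₂ (λ x y → x + y + suc (Z + R)) (sym good≡) (sym bad≡)) (total-suc φ unique)
      V-root : V true (contract (done true) ∘ φ) ≡ 1 * ((1 + Z + α) * P)
      V-root = trans
        (V-rooted m _ 0 (unique-contract (done true) (λ _ → refl) φ unique) (trans (good-contract-true φ unique) (cong suc good≡)))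
        (cong₂ (λ x y → x * ((1 + y + α) * P)) (nCn≡1 α)
          (trans (bad-contract-true φ) (trans (cong (Z +_) bad≡) (ℕ.+-identityʳ Z))))
      V-at : ∀ j → V false (contract (at false j) ∘ φ) ≡ P
      V-at j = V-unrooted m _ (unique-contract (at false j) (λ _ → refl) φ unique)
        (trans (good-contract-at φ j) good≡) (trans (bad-contract-at φ j) bad≡) 0<N
      arithmetic : ∀ Z R α P → 1 * (1 * ((1 + Z + α) * P)) + R * P ≡ (suc (Z + R) + α) * P
      arithmetic = solve-∀

  -- `opposite` gives position 0 to the largest label, which is contracted first.
  start : State N
  start c = at true (opposite c)

  unique-start : Unique start
  unique-start j = trans (sym (∑-permute (λ c → isAt j (at true c)) Permutation.reverse)) (diagonal j)
    where
    diagonal : ∀ {m} (j : Fin m) → ∑[ c < m ] isAt j (at true c) ≡ 1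
    diagonal {suc m} zero    = cong suc (sum-replicate-zero m)
    diagonal         (suc j) = diagonal j

  V-start : ∀ α → 0 < N → V α false start ≡ (N + α) ^ N
  V-start α = V-unrooted α N start unique-start (sum-replicate-zero N) (sum-replicate-zero N)

-- Counts as cardinalities.

Fin-∑ : ∀ {m} (f : Fin m → ℕ) → Fin (∑[ i < m ] f i) ↔ Σ (Fin m) (Fin ∘ f)
Fin-∑ {zero}  f = mk↔ₛ′ (λ ()) (λ ()) (λ ()) (λ ())
Fin-∑ {suc m} f = ↔-trans F.+↔⊎ (↔-trans (↔-refl ⊎-cong Fin-∑ (f ∘ suc)) assemble)
  where
  assemble : (Fin (f zero) ⊎ Σ (Fin m) (Fin ∘ f ∘ suc)) ↔ Σ (Fin (suc m)) (Fin ∘ f)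
  assemble = mk↔ₛ′
    (λ { (inj₁ x) → zero , x ; (inj₂ (i , x)) → suc i , x })
    (λ { (zero , x) → inj₁ x ; (suc i , x) → inj₂ (i , x) })
    (λ { (zero , x) → refl ; (suc i , x) → refl })
    (λ { (inj₁ x) → refl ; (inj₂ (i , x)) → refl })

count-↔ : ∀ {N m} (P : Vec (Fin N) m → Bool) → Fin (count P) ↔ Σ (Vec (Fin N) m) (T ∘ P)
count-↔ {m = zero} P with P [] in eq
... | true  = mk↔ₛ′ (λ _ → [] , subst T (sym eq) _) (λ _ → zero)
                    (λ { ([] , t) → cong ([] ,_) (T-irrelevant _ t) }) (λ { zero → refl })
... | false = mk↔ₛ′ (λ ()) (λ { ([] , t) → contradiction (subst T eq t) (λ ()) })
                    (λ { ([] , t) → contradiction (subst T eq t) (λ ()) }) (λ ())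
count-↔ {N} {suc m} P =
  ↔-trans (Fin-∑ (λ c → count (λ q → P (c ∷ q)))) (↔-trans (congˡ (λ {c} → count-↔ (λ q → P (c ∷ q)))) cons)
  where
  cons : Σ (Fin N) (λ c → Σ (Vec (Fin N) m) (λ q → T (P (c ∷ q)))) ↔ Σ (Vec (Fin N) (suc m)) (T ∘ P)
  cons = mk↔ₛ′ (λ { (c , q , t) → c ∷ q , t }) (λ { (c ∷ q , t) → c , q , t })
               (λ { (c ∷ q , t) → refl }) (λ { (c , q , t) → refl })

-- Paths, cycles and trees of a parent map.

iterate-+ : ∀ {A : Set} (g : A → A) x a b → iterate g x (a + b) ≡ iterate g (iterate g x a) b
iterate-+ g x zero    b = refl
iterate-+ g x (suc a) b = iterate-+ g (g x) a b

iterate-fixed : ∀ {A : Set} (g : A → A) {x} → g x ≡ x → ∀ a → iterate g x a ≡ x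
iterate-fixed g gx≡x zero    = refl
iterate-fixed g gx≡x (suc a) = trans (cong (λ y → iterate g y a) gx≡x) (iterate-fixed g gx≡x a)

==⇒≡ : ∀ {n} {u v : Vertex n} → T (u == v) → u ≡ v
==⇒≡ = toWitness

≡⇒== : ∀ {n} {u v : Vertex n} → u ≡ v → T (u == v)
≡⇒== = fromWitness

module _ {n : ℕ} (p : Vec (Vertex n) (suc n)) where

  par : Vertex n → Vertex n
  par = lookup p

  data Reach : Vertex n → Vertex n → Set where
    here  : ∀ {c} → Reach c c
    hence : ∀ {c d} → Reach (par c) d → Reach c d

  data Decreasing (r : Vertex n) : Vertex n → Set where
    trivial : Decreasing r r
    descend : ∀ {c} → c F.< par c → Decreasing r (par c) → Decreasing r c

  Tree : Vertex n → Set
  Tree r = par r ≡ r × (∀ c → Reach c r)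

  reach-trans : ∀ {a b c} → Reach a b → Reach b c → Reach a c
  reach-trans here      s = s
  reach-trans (hence r) s = hence (reach-trans r s)

  reach-iterate : ∀ a c → Reach c (iterate par c a)
  reach-iterate zero    c = here
  reach-iterate (suc a) c = hence (reach-iterate a (par c))

  decreasing⇒reach : ∀ {r c} → Decreasing r c → Reach c r
  decreasing⇒reach trivial       = here
  decreasing⇒reach (descend _ d) = hence (decreasing⇒reach d)

  reach-fixed : ∀ {c d} → par c ≡ c → Reach c d → c ≡ d
  reach-fixed {c} fix = go refl
    where
    go : ∀ {a d} → a ≡ c → Reach a d → c ≡ d
    go a≡c here      = sym a≡c
    go a≡c (hence r) = go (trans (cong par a≡c) fix) r

  reach-par : ∀ {c d} → Reach c d → Reach (par c) (par d)
  reach-par here      = here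
  reach-par (hence r) = reach-trans r (hence here)

  -- If `c` lies on a cycle, so does `par c`. The induction moves on to `par c`, and `cyc` leads
  -- from there back to `c`.
  reach-cycle : ∀ {c d} → Reach (par c) c → Reach c d → Reach d c
  reach-cycle cyc here      = here
  reach-cycle cyc (hence r) = reach-trans (reach-cycle (reach-par cyc) r) cyc

  -- A path that starts at a fixed vertex never leaves it. So the parent map alone determines the
  -- tree, as `parents-injective` requires.
  tree-unique : ∀ {r s} → Tree r → Tree s → r ≡ s
  tree-unique (fix , _) (_ , reach) = reach-fixed fix (reach _)

  -- A vertex on a cycle reaches the root, so by `reach-cycle` the root leads back to it; but the
  -- root leads only to itself.
  tree-acyclic : ∀ {r c} → Tree r → Reach (par c) c → c ≡ r
  tree-acyclic (fix , reach) cyc = sym (reach-fixed fix (reach-cycle cyc (reach _)))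

  -- Labels grow towards the root along a decreasing path, and beyond the root nothing new is met.
  decreasing-≤ : ∀ {r c d} → par r ≡ r → Decreasing r c → Reach c d → c F.≤ d
  decreasing-≤ fix trivial         s         = ℕ.≤-reflexive (cong toℕ (reach-fixed fix s))
  decreasing-≤ fix (descend c<p d) here      = ℕ.≤-refl
  decreasing-≤ fix (descend c<p d) (hence s) = ℕ.≤-trans (ℕ.<⇒≤ c<p) (decreasing-≤ fix d s)

  decreasingPath⇒decreasing : ∀ r a c → T (decreasingPath r p a c) → Decreasing r c
  decreasingPath⇒decreasing r zero    c t = subst (Decreasing r) (sym (==⇒≡ t)) trivial
  decreasingPath⇒decreasing r (suc a) c t with Equivalence.to T-∨ t
  ... | inj₁ c≡r = subst (Decreasing r) (sym (==⇒≡ c≡r)) trivial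
  ... | inj₂ u with Equivalence.to T-∧ u
  ...   | c<p , d = descend (ℕ.<ᵇ⇒< _ _ c<p) (decreasingPath⇒decreasing r a (par c) d)

  -- Each step of a decreasing path raises the label, and no label exceeds `n`; so from `c` at most
  -- `n` minus its label steps are taken.
  decreasing⇒decreasingPath : ∀ {r c} a → n ≤ toℕ c + a → Decreasing r c → T (decreasingPath r p a c)
  decreasing⇒decreasingPath zero    _ trivial = ≡⇒== refl
  decreasing⇒decreasingPath {r} (suc a) _ trivial = Equivalence.from (T-∨ {r == r}) (inj₁ (≡⇒== refl))
  decreasing⇒decreasingPath {c = c} zero n≤ (descend c<p _) =
    contradiction (ℕ.<-≤-trans c<p (ℕ.≤-trans (F.toℕ≤pred[n] (par c)) (subst (n ≤_) (ℕ.+-identityʳ _) n≤))) (ℕ.<-irrefl refl)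
  decreasing⇒decreasingPath {c = c} (suc a) n≤ (descend c<p d) = Equivalence.from T-∨ (inj₂ (Equivalence.from T-∧
    ( ℕ.<⇒<ᵇ c<p
    , decreasing⇒decreasingPath a (ℕ.≤-trans (subst (n ≤_) (ℕ.+-suc (toℕ c) a) n≤) (ℕ.+-monoˡ-≤ a c<p)) d)))

  -- If the n-th iterate is not `r`, no earlier one is, since `r` is fixed. Then n + 1 iterates take
  -- only n values (`punchOut` removes `r`), so two coincide and give a cycle away from the root.
  iterate-tree : ∀ {r} → Tree r → ∀ c → iterate par c n ≡ r
  iterate-tree {r} tree@(fix , reach) c with iterate par c n F.≟ r
  ... | yes eq = eq
  ... | no ≢r  = contradiction (sym (tree-acyclic tree cyc)) (missed i)
    where
    open ≡-Reasoning
    u : Fin (suc n) → Vertex n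
    u i = iterate par c (toℕ i)
    missed : ∀ i → r ≢ u i
    missed i r≡u = ≢r (begin
      iterate par c n                     ≡⟨ cong (iterate par c) (ℕ.m+[n∸m]≡n (F.toℕ≤pred[n] i)) ⟨
      iterate par c (toℕ i + (n ∸ toℕ i)) ≡⟨ iterate-+ par c (toℕ i) _ ⟩
      iterate par (u i) (n ∸ toℕ i)       ≡⟨ cong (λ x → iterate par x (n ∸ toℕ i)) r≡u ⟨
      iterate par r (n ∸ toℕ i)           ≡⟨ iterate-fixed par fix (n ∸ toℕ i) ⟩
      r                                   ∎)
    collision = F.pigeonhole (ℕ.n<1+n n) (λ i → punchOut (missed i))
    i = proj₁ collision
    j = proj₁ (proj₂ collision)
    i<j : i F.< j
    i<j = proj₁ (proj₂ (proj₂ collision))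
    u[i]≡u[j] : u i ≡ u j
    u[i]≡u[j] = F.punchOut-injective (missed i) (missed j) (proj₂ (proj₂ (proj₂ collision)))
    return : iterate par (par (u i)) (toℕ j ∸ suc (toℕ i)) ≡ u i
    return = begin
      iterate par (u i) (suc (toℕ j ∸ suc (toℕ i)))         ≡⟨ iterate-+ par c (toℕ i) _ ⟨
      iterate par c (toℕ i + suc (toℕ j ∸ suc (toℕ i)))     ≡⟨ cong (iterate par c) (ℕ.+-suc (toℕ i) _) ⟩
      iterate par c (suc (toℕ i) + (toℕ j ∸ suc (toℕ i)))   ≡⟨ cong (iterate par c) (ℕ.m+[n∸m]≡n i<j) ⟩
      u j                                                   ≡⟨ u[i]≡u[j] ⟨
      u i                                                   ∎
    cyc : Reach (par (u i)) (u i)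
    cyc = subst (Reach _) return (reach-iterate (toℕ j ∸ suc (toℕ i)) (par (u i)))

  reachesᵇ : Vertex n → Vertex n → Bool
  reachesᵇ r c = iterate par c n == r

  treeᵇ⇒tree : ∀ {r} → T (IsRootedTree n r p) → Tree r
  treeᵇ⇒tree {r} t with Equivalence.to (T-∧ {par r == r}) t
  ... | fix , reach = ==⇒≡ fix , λ c →
    subst (Reach c) (==⇒≡ (tabulate⁻ {f = λ d → d} (all⁺ (reachesᵇ r) (allFin (suc n)) reach) c)) (reach-iterate n c)

  tree⇒treeᵇ : ∀ {r} → Tree r → T (IsRootedTree n r p)
  tree⇒treeᵇ {r} tree@(fix , _) = Equivalence.from (T-∧ {par r == r})
    (≡⇒== fix , all⁻ (reachesᵇ r) (tabulate⁺ {f = λ c → c} (λ c → ≡⇒== (iterate-tree tree c))))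

  -- What the contraction process computes for a given parent map.

  -- ι enumerates the remaining vertices from the largest down.
  Meaning : ∀ {m} → Maybe (Vertex n) → (Fin m → Vertex n) → Vertex n → Target m → Set
  Meaning root ι c (at true j)  = c ≡ ι j
  Meaning root ι c (at false j) = (∀ i → ι i F.< c) × Reach c (ι j)
  Meaning root ι c (done true)  = (∀ i → ι i F.< c) × (∃ λ r → root ≡ just r × Decreasing r c)
  Meaning root ι c (done false) = (∀ i → ι i F.< c) × (∃ λ r → root ≡ just r × Reach c r × ¬ Decreasing r c)

  record Invariant {m} (root : Maybe (Vertex n)) (ι : Fin m → Vertex n) (φ : State {suc n} m) : Set where
    field
      meaning   : ∀ c → Meaning root ι c (φ c)
      remaining : ∀ j → φ (ι j) ≡ at true j
      antitone  : ∀ {i j} → i F.< j → ι j F.< ι i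
      rooted    : ∀ {r} → root ≡ just r → par r ≡ r × φ r ≡ done true

  module _ {m} {root : Maybe (Vertex n)} {ι : Fin (suc m) → Vertex n} {φ : State (suc m)}
           (inv : Invariant root ι φ) where
    open Invariant inv

    v : Vertex n
    v = ι zero

    -- All choices of a parent are treated at once: `t` only has to describe `v` after the
    -- contraction, and the labels merged into `v` follow it. Having `root′` besides `root` covers
    -- the step that meets the root.
    contract-invariant : ∀ {root′} t → Meaning root′ (ι ∘ suc) v t →
      (∀ {r} → root ≡ just r → root′ ≡ just r) →
      (∀ {r} → root′ ≡ just r → par r ≡ r × contract t (φ r) ≡ done true) →
      Invariant root′ (ι ∘ suc) (contract t ∘ φ)
    contract-invariant {root′} t t-meaning extends rooted′ = record
      { meaning   = λ c → contracted c (φ c) (meaning c)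
      ; remaining = λ j → cong (contract t) (remaining (suc j))
      ; antitone  = λ i<j → antitone (s≤s i<j)
      ; rooted    = rooted′
      }
      where
      -- A path from c that leaves through the smaller vertex v is not decreasing.
      not-decreasing : ∀ {c r} → v F.< c → Reach c v → root′ ≡ just r → ¬ Decreasing r c
      not-decreasing v<c s eq d = ℕ.<⇒≱ v<c (decreasing-≤ (proj₁ (rooted′ eq)) d s)

      blocked : ∀ c t → (∀ i → ι i F.< c) → Reach c v → Meaning root′ (ι ∘ suc) v t →
        Meaning root′ (ι ∘ suc) c (block t)
      blocked c (at true j)  ι< s v≡                    = (ι< ∘ suc) , subst (Reach c) v≡ s
      blocked c (at false j) ι< s (_ , s′)              = (ι< ∘ suc) , reach-trans s s′
      blocked c (done true)  ι< s (_ , r , eq , d)      =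
        (ι< ∘ suc) , r , eq , reach-trans s (decreasing⇒reach d) , not-decreasing (ι< zero) s eq
      blocked c (done false) ι< s (_ , r , eq , s′ , _) =
        (ι< ∘ suc) , r , eq , reach-trans s s′ , not-decreasing (ι< zero) s eq

      contracted : ∀ c x → Meaning root ι c x → Meaning root′ (ι ∘ suc) c (contract t x)
      contracted c (at true zero)     refl                    = t-meaning
      contracted c (at false zero)    (ι< , s)                = blocked c t ι< s t-meaning
      contracted c (at true (suc j))  c≡                      = c≡
      contracted c (at false (suc j)) (ι< , s)                = (ι< ∘ suc) , s
      contracted c (done true)        (ι< , r , eq , d)       = (ι< ∘ suc) , r , extends eq , d
      contracted c (done false)       (ι< , r , eq , s , ¬d)  = (ι< ∘ suc) , r , extends eq , s , ¬d

    -- A rejection has to exclude every root, since the root is not known in advance.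
    Advance : Maybe (Bool × State {suc n} m) → Set
    Advance x = (x ≡ nothing × (∀ r → ¬ Tree r))
      ⊎ (∃₂ λ root′ ψ → x ≡ just (is-just root′ , ψ) × Invariant root′ (ι ∘ suc) ψ)

    contract-same-root : ∀ t → Meaning root (ι ∘ suc) v t →
      Advance (just (is-just root , contract t ∘ φ))
    contract-same-root t t-meaning = inj₂ (root , _ , refl ,
      contract-invariant t t-meaning (λ eq → eq) (λ eq → proj₁ (rooted eq) , cong (contract t) (proj₂ (rooted eq))))

    v-above : ∀ j → ι (suc j) F.< v
    v-above j = antitone (s≤s z≤n)

    root≢v : ∀ {r} → root ≡ just r → r ≢ v
    root≢v eq refl = contradiction (trans (sym (proj₂ (rooted eq))) (remaining zero)) (λ ())

    -- If a root was met before, there are now two fixed vertices, and the root of a tree would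
    -- equal both. `R` is a copy of `root` that can be matched on.
    advance-root : ∀ R → root ≡ R → par v ≡ v → Advance (step (is-just R) φ (at true zero))
    advance-root nothing eq fix = inj₂ (just v , _ , refl , contract-invariant (done true)
      (v-above , v , refl , trivial) (λ eq′ → contradiction (trans (sym eq) eq′) (λ ()))
      λ { refl → fix , cong (contract (done true)) (remaining zero) })
    advance-root (just r) eq fix = inj₁ (refl , λ s (s-fix , reach) →
      root≢v eq (trans (reach-fixed (proj₁ (rooted eq)) (reach r)) (sym (reach-fixed fix (reach v)))))

    advance : ∀ x → Meaning root ι (par v) x → Advance (step (is-just root) φ x)
    advance (at true zero)     fix      = advance-root root refl fix
    -- The parent of `v` was merged into `v`, which closes a cycle. In a tree `v` would then be the
    -- root and its own parent, but labels merged into `v` are larger than `v`.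
    advance (at false zero)    (ι< , s) = inj₁ (refl , λ r tree →
      ℕ.<-irrefl (cong toℕ (trans (tree-acyclic tree s) (trans (sym (proj₁ tree)) (cong par (sym (tree-acyclic tree s)))))) (ι< zero))
    advance (at true (suc j))  eq       = contract-same-root (at false j)
      (v-above , hence (subst (λ c → Reach c (ι (suc j))) (sym eq) here))
    advance (at false (suc j)) (ι< , s) = contract-same-root (at false j) (v-above , hence s)
    -- A finished parent is larger than `v`, so `v` is good exactly when its parent is; in the bad
    -- case `root≢v` excludes the trivial path.
    advance (done true)  (ι< , r , eq , d) = contract-same-root (done true)
      (v-above , r , eq , descend (ι< zero) d)
    advance (done false) (ι< , r , eq , s , ¬d) = contract-same-root (done false)
      (v-above , r , eq , hence s , λ { trivial → root≢v eq refl ; (descend _ d) → ¬d d })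

  final-tree : ∀ {root ι} {φ : State 0} → Invariant root ι φ →
    ∃ λ r → Tree r × (∀ c → good (φ c) ≡ indicator (decreasingPath r p n c))
  final-tree {root} {ι} {φ} inv = r , (proj₁ (rooted eq) , reach) , λ c → good≡ c (φ c) (meaning c)
    where
    open Invariant inv
    some-root : ∀ {c} t → Meaning root ι c t → ∃ λ r → root ≡ just r
    some-root (done true)  (_ , r , eq , _) = r , eq
    some-root (done false) (_ , r , eq , _) = r , eq
    -- With no vertex left, label 0 is finished too, and its meaning supplies the root.
    r = proj₁ (some-root (φ zero) (meaning zero))
    eq : root ≡ just r
    eq = proj₂ (some-root (φ zero) (meaning zero))
    same : ∀ {s} → root ≡ just s → s ≡ r
    same eq′ = just-injective (trans (sym eq′) eq)
    reach′ : ∀ c t → Meaning root ι c t → Reach c r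
    reach′ c (done true)  (_ , s , eq′ , d)     = subst (Reach c) (same eq′) (decreasing⇒reach d)
    reach′ c (done false) (_ , s , eq′ , t , _) = subst (Reach c) (same eq′) t
    reach : ∀ c → Reach c r
    reach c = reach′ c (φ c) (meaning c)
    good≡ : ∀ c t → Meaning root ι c t → good t ≡ indicator (decreasingPath r p n c)
    good≡ c (done true) (_ , s , eq′ , d) = sym (cong indicator (Equivalence.to T-≡
      (decreasing⇒decreasingPath n (ℕ.m≤n+m n (toℕ c)) (subst (λ s → Decreasing s c) (same eq′) d))))
    good≡ c (done false) (_ , s , eq′ , _ , ¬d) with decreasingPath r p n c in path
    ... | false = refl
    ... | true  = contradiction
      (subst (λ s → Decreasing s c) (sym (same eq′)) (decreasingPath⇒decreasing r n c (Equivalence.from T-≡ path))) ¬d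

  mdCount : Vertex n → ℕ
  mdCount r = length (filterᵇ (decreasingPath r p n) (allFin (suc n)))

  -- Whether a cycle or a second root occurs depends on the parent map and not on `k`, so one
  -- alternative holds for all `k` at once.
  RunSpec : (ℕ → Bool) → Set
  RunSpec b = (∃ λ r → Tree r × (∀ k → b k ≡ (mdCount r ≡ᵇ suc k)))
            ⊎ ((∀ r → ¬ Tree r) × (∀ k → b k ≡ false))

  run-spec : ∀ {m root ι} {φ : State m} → Invariant root ι φ →
    (q : Vec (Vertex n) m) → (∀ j → lookup q j ≡ par (ι j)) →
    RunSpec (λ k → run k (is-just root) φ q)
  run-spec {φ = φ} inv [] _ with final-tree inv
  ... | r , tree , good≡ = inj₁ (r , tree , λ k → cong (_≡ᵇ suc k)
    (trans (sum-cong-≗ good≡) (sym (length-filterᵇ-tabulate (decreasingPath r p n) (λ c → c)))))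
  run-spec {root = root} {ι} {φ} inv (c ∷ q) q≡ =
    proceed (advance inv (φ c) (subst (λ d → Meaning root ι d (φ c)) (q≡ zero) (Invariant.meaning inv c)))
    where
    proceed : ∀ {x} → Advance inv x →
      RunSpec (λ k → maybe (λ (b , ψ) → run k b ψ q) false x)
    proceed (inj₁ (refl , ¬tree))          = inj₂ (¬tree , λ _ → refl)
    proceed (inj₂ (_ , _ , refl , inv′)) = run-spec inv′ q (q≡ ∘ suc)

  start-invariant : Invariant nothing opposite start
  start-invariant = record
    { meaning   = λ c → sym (F.opposite-involutive c)
    ; remaining = λ j → cong (at true) (F.opposite-involutive j)
    ; antitone  = opposite-antitone
    ; rooted    = λ ()
    }
    where
    opposite-antitone : ∀ {i j : Fin (suc n)} → i F.< j → opposite j F.< opposite i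
    opposite-antitone {i} {j} i<j rewrite F.opposite-prop i | F.opposite-prop j =
      ℕ.∸-monoʳ-< i<j (F.toℕ≤pred[n] j)

-- Trees as accepted parent vectors, and the theorem.

-- `run` reads the parents starting with that of the largest vertex.
mirror : ∀ {A : Set} {m} → Vec A m → Vec A m
mirror q = Vec.tabulate (lookup q ∘ opposite)

lookup-mirror : ∀ {A : Set} {m} (q : Vec A m) i → lookup (mirror q) i ≡ lookup q (opposite i)
lookup-mirror q = lookup∘tabulate (lookup q ∘ opposite)

mirror-involutive : ∀ {A : Set} {m} (q : Vec A m) → mirror (mirror q) ≡ q
mirror-involutive q = begin
  Vec.tabulate (lookup (mirror q) ∘ opposite)      ≡⟨ tabulate-cong (λ i → lookup-mirror q (opposite i)) ⟩
  Vec.tabulate (lookup q ∘ opposite ∘ opposite)    ≡⟨ tabulate-cong (λ i → cong (lookup q) (F.opposite-involutive i)) ⟩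
  Vec.tabulate (lookup q)                          ≡⟨ tabulate∘lookup q ⟩
  q                                                ∎
  where open ≡-Reasoning

parents : ∀ {n k} → TreeNK n k → Vec (Vertex n) (suc n)
parents (((r , p) , _) , _) = p

parents-injective : ∀ {n k} (s t : TreeNK n k) → parents s ≡ parents t → s ≡ t
parents-injective (((r , p) , x) , e) (((r′ , p) , x′) , e′) refl
  with tree-unique p (treeᵇ⇒tree p x) (treeᵇ⇒tree p x′)
... | refl with T-irrelevant x x′
...   | refl = cong (_ ,_) (ℕ.≡-irrelevant e e′)

-- The right side forgets the root. `from` takes the one found by `run-spec`, and
-- `parents-injective` identifies the result with the original tree.
TreeNK-↔ : ∀ n k → TreeNK n k ↔ Σ (Vec (Vertex n) (suc n)) (T ∘ run k false start)
TreeNK-↔ n k = mk↔ₛ′ to from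
  (λ (q , t) → Σ-≡ (mirror-involutive q))
  (λ s → parents-injective _ s (mirror-involutive (parents s)))
  where
  spec : ∀ p → RunSpec p (λ k → run k false start (mirror p))
  spec p = run-spec p (start-invariant p) (mirror p) (lookup-mirror p)

  accepts : ∀ p r → Tree p r → mdCount p r ≡ suc k → T (run k false start (mirror p))
  accepts p r tree md with spec p
  ... | inj₁ (s , tree′ , run≡) = subst T (sym (run≡ k))
    (ℕ.≡⇒≡ᵇ _ _ (trans (cong (mdCount p) (tree-unique p tree′ tree)) md))
  ... | inj₂ (¬tree , _)        = contradiction tree (¬tree r)

  accepted : ∀ p → T (run k false start (mirror p)) → ∃ λ r → Tree p r × mdCount p r ≡ suc k
  accepted p t with spec p
  ... | inj₁ (s , tree , run≡) = s , tree , ℕ.≡ᵇ⇒≡ _ _ (subst T (run≡ k) t)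
  ... | inj₂ (_ , run≡)        = contradiction (subst T (run≡ k) t) (λ ())

  to : TreeNK n k → Σ (Vec (Vertex n) (suc n)) (T ∘ run k false start)
  to (((r , p) , x) , md) = mirror p , accepts p r (treeᵇ⇒tree p x) md

  from : Σ (Vec (Vertex n) (suc n)) (T ∘ run k false start) → TreeNK n k
  from (q , t) with accepted (mirror q) (subst (T ∘ run k false start) (sym (mirror-involutive q)) t)
  ... | r , tree , md = ((r , mirror q) , tree⇒treeᵇ (mirror q) tree) , md

  Σ-≡ : ∀ {x y : Σ (Vec (Vertex n) (suc n)) (T ∘ run k false start)} → proj₁ x ≡ proj₁ y → x ≡ y
  Σ-≡ {q , t} {q , t′} refl = cong (q ,_) (T-irrelevant t t′)

theorem3p3 : (n α : ℕ) (c : ℕ → ℕ) → (∀ k → Fin (c k) ↔ TreeNK n k) →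
    sumTo n (λ k → ((k + α) C α) * c k) ≡ (suc n + α) ^ n
-- `V` carries one more factor `N + α` than the sum; for `N = suc n` it is positive and can be
-- cancelled.
theorem3p3 n α c c↔ = ℕ.*-cancelʳ-≡ _ _ (suc n + α) (begin
  sumTo n (λ k → ((k + α) C α) * c k) * (suc n + α)
    ≡⟨ cong (_* (suc n + α)) (sum-applyUpTo (λ k → ((k + α) C α) * c k) (λ k → k) (suc n)) ⟩
  ∑[ k < suc n ] (((toℕ k + α) C α) * c (toℕ k)) * (suc n + α)
    ≡⟨ cong (_* (suc n + α)) (sum-cong-≗ {suc n} (λ k → cong (((toℕ k + α) C α) *_) (c≡count (toℕ k)))) ⟩
  V α false (start {suc n})
    ≡⟨ V-start α (s≤s z≤n) ⟩
  (suc n + α) ^ suc n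
    ≡⟨ ℕ.*-comm (suc n + α) _ ⟩
  (suc n + α) ^ n * (suc n + α) ∎)
  where
  open ≡-Reasoning
  c≡count : ∀ k → c k ≡ count (run {suc n} k false start)
  c≡count k = Permutation.↔⇒≡ (↔-trans (c↔ k) (↔-trans (TreeNK-↔ n k) (↔-sym (count-↔ (run k false start)))))
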